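{- Let $T$ be an h-inductive theory in a first-order language $L$ and let $A$ be a model of $T$. Then $A$ is an amalgamation basis of $T$ if and only if there exist a pc model $A_e$ of $T$ and a homomorphism $f:A\to A_e$ such that for every positive formula $\varphi(\bar x)$ and every tuple $\bar a$ of $A$ (of the length of $\bar x$): if $A_e\not\models\varphi(f(\bar a))$, then there is $\varphi^c\in Res_T(\varphi)$ such that $A\models\varphi^c(\bar a)$.
   Context: Let $L$ be a first-order language with equality. A positive formula is one obtained from atomic formulas (including falsity $\bot$) using $\exists,\vee,\wedge$. An h-inductive sentence is a finite conjunction of sentences $\forall\bar x(\exists\bar y\,\varphi(\bar x,\bar y)\rightarrow\exists\bar z\,\psi(\bar x,\bar z))$ with $\varphi,\psi$ quantifier-free positive. An h-inductive theory is a theory axiomatized by h-inductive sentences. A homomorphism $f:A\to B$ of $L$-structures is a map such that $A\models\phi(\bar a)$ implies $B\models\phi(f(\bar a))$ for every atomic $\phi$ and tuple $\bar a$ of $A$; it is an immersion if $\bar a$ and $f(\bar a)$ satisfy the same positive formulas for every tuple $\bar a$ of $A$. A model $M$ of $T$ is a pc (positively existentially closed) model of $T$ if every homomorphism from $M$ into a model of $T$ is an immersion. A model $A$ of $T$ is an amalgamation basis of $T$ if for all models $B,C$ of $T$ and homomorphisms $f:A\to B$, $g:A\to C$ there are a model $D$ of $T$ and homomorphisms $g':B\to D$, $f':C\to D$ with $g'\circ f=f'\circ g$. For a positive formula $\varphi(\bar x)$, $Res_T(\varphi)$ is the set of positive formulas $\psi(\bar x)$ (in the same free variables) such that $T\vdash\neg\exists\bar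 x(\varphi(\bar x)\wedge\psi(\bar x))$. -}

module Defs where

open import Level using (Level; suc; Lift)
open import Data.Empty using (⊥)
open import Data.Fin.Base using (Fin)
open import Data.List.Base using (List)
open import Data.List.Relation.Unary.All using (All)
open import Data.Nat.Base as ℕ using (ℕ; _+_)
open import Data.Product.Base using (Σ; ∃; _×_)
open import Data.Sum.Base using (_⊎_)
open import Data.Vec.Functional using (Vector; _∷_; _++_)
open import Function.Base using (_∘_)
open import Function.Bundles using (_⇔_)
open import Relation.Binary.PropositionalEquality.Core using (_≡_)
open import Relation.Nullary.Negation.Core using (¬_)
open import Relation.Unary using (Pred)

private
  variable
    ℓ : Level
    n : ℕ

record Language (ℓ : Level) : Set (suc ℓ) where
  field
    Func : ℕ → Set ℓ
    Rel  : ℕ → Set ℓ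

open Language public

-- The index n is the length of the tuple of free variables.

data Term (L : Language ℓ) (n : ℕ) : Set ℓ where
  var : Fin n → Term L n
  app : ∀ {k} → Func L k → Vector (Term L n) k → Term L n

data Atomic (L : Language ℓ) (n : ℕ) : Set ℓ where
  falsity : Atomic L n
  _≐_     : Term L n → Term L n → Atomic L n
  rel     : ∀ {k} → Rel L k → Vector (Term L n) k → Atomic L n

-- ∃' binds variable zero of its body.

data Positive (L : Language ℓ) (n : ℕ) : Set ℓ where
  atom      : Atomic L n → Positive L n
  _∧'_ _∨'_ : Positive L n → Positive L n → Positive L n
  ∃'        : Positive L (ℕ.suc n) → Positive L n

data QuantifierFree {L : Language ℓ} {n : ℕ} : Positive L n → Set ℓ where
  atom : (α : Atomic L n) → QuantifierFree (atom α)
  _∧'_ : ∀ {φ ψ} → QuantifierFree φ → QuantifierFree ψ → QuantifierFree (φ ∧' ψ)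
  _∨'_ : ∀ {φ ψ} → QuantifierFree φ → QuantifierFree ψ → QuantifierFree (φ ∨' ψ)

-- ∀ x̄ (∃ ȳ φ(x̄, ȳ) → ∃ z̄ ψ(x̄, z̄)), with x̄, ȳ, z̄ of lengths #x, #y, #z.

record BasicHInductive (L : Language ℓ) : Set ℓ where
  field
    #x #y #z : ℕ
    φ        : Positive L (#x + #y)
    ψ        : Positive L (#x + #z)
    φ-qf     : QuantifierFree φ
    ψ-qf     : QuantifierFree ψ

-- A list stands for the conjunction of its members.

HInductiveSentence : Language ℓ → Set ℓ
HInductiveSentence L = List (BasicHInductive L)

-- An h-inductive theory is presented by its set of h-inductive axioms.

HInductiveTheory : Language ℓ → Set (suc ℓ)
HInductiveTheory {ℓ} L = Pred (HInductiveSentence L) ℓ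

-- Following the usual convention, structures are nonempty; homomorphisms
-- need not respect the chosen inhabitant.

record Structure (L : Language ℓ) : Set (suc ℓ) where
  field
    Carrier    : Set ℓ
    inhabitant : Carrier
    funcᴹ      : ∀ {k} → Func L k → Vector Carrier k → Carrier
    relᴹ       : ∀ {k} → Rel L k → Pred (Vector Carrier k) ℓ

open Structure public using (Carrier; funcᴹ; relᴹ)

module _ {L : Language ℓ} where

  eval : (M : Structure L) → Vector (Carrier M) n → Term L n → Carrier M
  eval M ā (var i)    = ā i
  eval M ā (app g ts) = funcᴹ M g (λ i → eval M ā (ts i))

  infix 4 _⊨ₐ_[_] _⊨_[_] _⊨ᵇ_ _⊨ˢ_ _⊨ᵀ_

  _⊨ₐ_[_] : (M : Structure L) → Atomic L n → Vector (Carrier M) n → Set ℓ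
  M ⊨ₐ falsity  [ ā ] = Lift ℓ ⊥
  M ⊨ₐ s ≐ t    [ ā ] = eval M ā s ≡ eval M ā t
  M ⊨ₐ rel R ts [ ā ] = relᴹ M R (λ i → eval M ā (ts i))

  _⊨_[_] : (M : Structure L) → Positive L n → Vector (Carrier M) n → Set ℓ
  M ⊨ atom α [ ā ] = M ⊨ₐ α [ ā ]
  M ⊨ φ ∧' ψ [ ā ] = M ⊨ φ [ ā ] × M ⊨ ψ [ ā ]
  M ⊨ φ ∨' ψ [ ā ] = M ⊨ φ [ ā ] ⊎ M ⊨ ψ [ ā ]
  M ⊨ ∃' φ   [ ā ] = ∃ λ (b : Carrier M) → M ⊨ φ [ b ∷ ā ]

  _⊨ᵇ_ : Structure L → BasicHInductive L → Set ℓ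
  M ⊨ᵇ σ = (x̄ : Vector (Carrier M) #x) →
           (∃ λ (ȳ : Vector (Carrier M) #y) → M ⊨ φ [ x̄ ++ ȳ ]) →
           (∃ λ (z̄ : Vector (Carrier M) #z) → M ⊨ ψ [ x̄ ++ z̄ ])
    where open BasicHInductive σ

  _⊨ˢ_ : Structure L → HInductiveSentence L → Set ℓ
  M ⊨ˢ χ = All (M ⊨ᵇ_) χ

  _⊨ᵀ_ : Structure L → HInductiveTheory L → Set ℓ
  M ⊨ᵀ T = ∀ χ → T χ → M ⊨ˢ χ

  -- T ⊢ ¬∃ x̄ (φ ∧ ψ) is read as logical consequence: the sentence holds
  -- in every model of T.

  Res : HInductiveTheory L → Positive L n → Pred (Positive L n) (suc ℓ)
  Res {n} T φ ψ = (M : Structure L) → M ⊨ᵀ T →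
    ¬ (∃ λ (x̄ : Vector (Carrier M) n) → M ⊨ φ ∧' ψ [ x̄ ])

  record Hom (A B : Structure L) : Set ℓ where
    field
      map       : Carrier A → Carrier B
      preserves : ∀ {n} (α : Atomic L n) (ā : Vector (Carrier A) n) →
                  A ⊨ₐ α [ ā ] → B ⊨ₐ α [ map ∘ ā ]

  open Hom public using (map)

  IsImmersion : {A B : Structure L} → Hom A B → Set ℓ
  IsImmersion {A} {B} f =
    ∀ {n} (φ : Positive L n) (ā : Vector (Carrier A) n) →
    A ⊨ φ [ ā ] ⇔ B ⊨ φ [ map f ∘ ā ]

  IsPCModel : HInductiveTheory L → Structure L → Set (suc ℓ)
  IsPCModel T M = M ⊨ᵀ T ×
    ((N : Structure L) → N ⊨ᵀ T → (f : Hom M N) → IsImmersion f)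

  IsAmalgamationBasis : HInductiveTheory L → Structure L → Set (suc ℓ)
  IsAmalgamationBasis T A = A ⊨ᵀ T ×
    ((B C : Structure L) → B ⊨ᵀ T → C ⊨ᵀ T → (f : Hom A B) (g : Hom A C) →
     Σ (Structure L) λ D → D ⊨ᵀ T ×
     Σ (Hom B D) λ g' → Σ (Hom C D) λ f' →
     ∀ a → map g' (map f a) ≡ map f' (map g a))

{-# OPTIONS --safe #-}
module Submission where

-- If A is an amalgamation basis, take a pc model Aₑ continuing A.  When no
-- element of Res T φ holds at ā, the diagram of A together with φ(ā) has a
-- model B; amalgamating B with Aₑ and using that Aₑ is pc gives Aₑ ⊨ φ(ā).
-- Conversely the condition on Aₑ says that a positive formula true of ā in some
-- continuation of A is already true of it in Aₑ, so Aₑ realises every finite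
-- part of the diagrams of B and C glued along A, and compactness amalgamates.
--
-- Compactness and the existence of pc models come from one construction: among
-- the finitely satisfiable sets of positive facts with parameters in a supply of
-- witness constants, each of which may be used only once the formula it is meant
-- to witness is in the set, a maximal one is the positive theory of a pc model.

open import Defs
open import Level using (Level; Lift; lift; lower)
open import Axiom.ExcludedMiddle using (ExcludedMiddle)
open import Axiom.Extensionality.Propositional using (Extensionality)
open import Data.Bool.Base using (Bool; true; false; T)
open import Data.Empty using (⊥; ⊥-elim)
open import Data.Fin.Base as Fin using (Fin; zero; suc; _↑ˡ_; _↑ʳ_; splitAt)
open import Data.List.Base as List using (List; []; _∷_)
open import Data.List.Membership.Propositional using () renaming (_∈_ to _∈ᴸ_)
open import Data.List.Relation.Unary.All as All using (All; []; _∷_)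
open import Data.List.Relation.Unary.All.Properties
  using (++⁺; ++⁻ˡ; ++⁻ʳ; concat⁺; concat⁻; tabulate⁺; tabulate⁻)
open import Data.Nat.Base as ℕ using (ℕ; _+_)
open import Data.Product.Base using (Σ; ∃; _×_; _,_; proj₁; proj₂)
open import Data.Sum.Base as Sum using (_⊎_; inj₁; inj₂)
open import Data.Unit.Base using (⊤; tt)
open import Data.Vec.Functional using (Vector; _++_) renaming ([] to []ᵛ; _∷_ to _∷ᵛ_)
open import Data.Vec.Functional.Properties using (lookup-++ˡ; lookup-++ʳ)
open import Function.Base using (_∘_; id)
open import Function.Bundles using (_⇔_; mk⇔; Equivalence)
open import Relation.Binary.PropositionalEquality
  using (_≡_; refl; sym; trans; cong; cong₂; subst)
open import Relation.Nullary.Decidable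
  using (Dec; yes; no; ⌊_⌋; toWitness; fromWitness; decidable-stable; recompute)
open import Relation.Nullary.Negation.Core using (¬_; contradiction)
open import Relation.Unary using (Pred; _∈_)

open Equivalence using (to; from)

private
  variable
    a b ℓ x y : Level
    m n k : ℕ
    L : Language ℓ

-- Renaming of variables, quantifier blocks, finite conjunctions.

renameᵗ : (Fin m → Fin n) → Term L m → Term L n
renameᵗ ρ (var i)    = var (ρ i)
renameᵗ ρ (app g ts) = app g (λ i → renameᵗ ρ (ts i))

rename : (Fin m → Fin n) → Positive L m → Positive L n
rename ρ (atom falsity)    = atom falsity
rename ρ (atom (s ≐ t))    = atom (renameᵗ ρ s ≐ renameᵗ ρ t)
rename ρ (atom (rel R ts)) = atom (rel R (λ i → renameᵗ ρ (ts i)))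
rename ρ (φ ∧' ψ)          = rename ρ φ ∧' rename ρ ψ
rename ρ (φ ∨' ψ)          = rename ρ φ ∨' rename ρ ψ
rename ρ (∃' φ)            = ∃' (rename (Fin.lift 1 ρ) φ)

∃* : ∀ k → Positive L (k + n) → Positive L n
∃* ℕ.zero    φ = φ
∃* (ℕ.suc k) φ = ∃* k (∃' φ)

-- With no free variables there may be no closed term to form an equation from, so truth is
-- expressed by a quantifier; it holds because structures are nonempty.
verum : Positive L n
verum = ∃' (atom (var zero ≐ var zero))

⋀ : (Fin k → Positive L n) → Positive L n
⋀ {k = ℕ.zero}  φ = verum
⋀ {k = ℕ.suc k} φ = φ zero ∧' ⋀ (φ ∘ suc)

⋀-intro : (M : Structure L) (φ : Fin k → Positive L n) {ā : Vector (Carrier M) n} →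
          (∀ i → M ⊨ φ i [ ā ]) → M ⊨ ⋀ φ [ ā ]
⋀-intro {k = ℕ.zero}  M φ p = Structure.inhabitant M , refl
⋀-intro {k = ℕ.suc k} M φ p = p zero , ⋀-intro M (φ ∘ suc) (p ∘ suc)

⋀-elim : (M : Structure L) (φ : Fin k → Positive L n) {ā : Vector (Carrier M) n} →
         M ⊨ ⋀ φ [ ā ] → ∀ i → M ⊨ φ i [ ā ]
⋀-elim M φ (p , q) zero    = p
⋀-elim M φ (p , q) (suc i) = ⋀-elim M (φ ∘ suc) q i

-- Positive facts with parameters, and their satisfiability.

record Fact (L : Language ℓ) (X : Set ℓ) : Set ℓ where
  constructor _at_
  field
    {arity} : ℕ
    formula : Positive L arity
    params  : Vector X arity

open Fact

Holds : (M : Structure L) {X : Set _} → (X → Carrier M) → Fact L X → Set _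
Holds M e (φ at v̄) = M ⊨ φ [ e ∘ v̄ ]

Satisfiable : HInductiveTheory L → {X : Set _} → List (Fact L X) → Set _
Satisfiable {L = L} T {X} fs =
  Σ (Structure L) λ M → M ⊨ᵀ T × Σ (X → Carrier M) λ e → All (Holds M e) fs

FinitelySatisfiable : HInductiveTheory L → {X : Set _} → (Fact L X → Set x) → Set _
FinitelySatisfiable T Δ = ∀ fs → All Δ fs → Satisfiable T fs

map-∷ : {A : Set a} {B : Set b} (f : A → B) (x : A) (x̄ : Vector A n) →
        ∀ i → (f ∘ (x ∷ᵛ x̄)) i ≡ (f x ∷ᵛ (f ∘ x̄)) i
map-∷ f x x̄ zero    = refl
map-∷ f x x̄ (suc i) = refl

map-++ : {A : Set a} {B : Set b} (f : A → B) (x̄ : Vector A m) (ȳ : Vector A n) →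
         ∀ i → (f ∘ (x̄ ++ ȳ)) i ≡ ((f ∘ x̄) ++ (f ∘ ȳ)) i
map-++ {m = m} f x̄ ȳ i with splitAt m i
... | inj₁ _ = refl
... | inj₂ _ = refl

-- Reduces a finite part of a set enlarged by `c` to a finite part of the original set.
separate : {A : Set a} {P : A → Set b} {c : A} (xs : List A) → All (λ x → P x ⊎ x ≡ c) xs →
           ∃ λ ys → All P ys × ({Q : A → Set y} → Q c → All Q ys → All Q xs)
separate []       []              = [] , [] , λ _ _ → []
separate {y = y} (x ∷ xs) (p ∷ ps) with p | separate {y = y} xs ps
... | inj₁ Px   | ys , Pys , restore = x ∷ ys , Px ∷ Pys , λ { Qc (Qx ∷ Qys) → Qx ∷ restore Qc Qys }
... | inj₂ refl | ys , Pys , restore = ys , Pys , λ Qc Qys → Qc ∷ restore Qc Qys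

-- wit φ v̄ names an element satisfying φ(–, v̄), if there is one.

data Constant (L : Language ℓ) (X : Set ℓ) : Set ℓ where
  base : X → Constant L X
  wit  : Positive L (ℕ.suc n) → Vector (Constant L X) n → Constant L X

-- Excluded middle, extensionality and Bool-valued subsets.

module Classical (em : ∀ a → ExcludedMiddle a) (fe : ∀ a b → Extensionality a b) where

  decide : (P : Set a) → Dec P
  decide P = em _ {P}

  stable : {P : Set a} → ¬ ¬ P → P
  stable {P = P} = decidable-stable (decide P)

  ext : {A : Set a} {B : A → Set b} {f g : ∀ x → B x} → (∀ x → f x ≡ g x) → f ≡ g
  ext = fe _ _

  ⟪_⟫ : {S : Set x} → Pred S a → S → Bool
  ⟪ Q ⟫ s = ⌊ decide (Q s) ⌋

  ⟪⟫-intro : {S : Set x} (Q : Pred S a) {s : S} → Q s → T (⟪ Q ⟫ s)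
  ⟪⟫-intro Q {s} = fromWitness {a? = decide (Q s)}

  ⟪⟫-elim : {S : Set x} (Q : Pred S a) {s : S} → T (⟪ Q ⟫ s) → Q s
  ⟪⟫-elim Q {s} = toWitness {a? = decide (Q s)}

  module _ {S : Set x} where

    infix 4 _⊑_

    _⊑_ : (S → Bool) → (S → Bool) → Set x
    c ⊑ d = ∀ {s} → T (c s) → T (d s)

    ⊑-antisym : ∀ {c d} → c ⊑ d → d ⊑ c → c ≡ d
    ⊑-antisym c⊑d d⊑c = ext λ s → T-antisym _ _ (c⊑d {s}) d⊑c
      where
      T-antisym : ∀ p q → (T p → T q) → (T q → T p) → p ≡ q
      T-antisym false false _ _ = refl
      T-antisym false true  _ g = ⊥-elim (g tt)
      T-antisym true  false f _ = ⊥-elim (f tt)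
      T-antisym true  true  _ _ = refl

  -- Zorn's lemma for families of subsets, by the Bourbaki–Witt argument: the
  -- tower generated from bot by grow and unions is a chain.  Subsets are
  -- Bool-valued so that the tower stays in the universe of S.

  module Zorn {S : Set x} (F : (S → Bool) → Set y) (bot : S → Bool)
    (F-bot : F bot)
    (F-local : ∀ c → (∀ ss → All (T ∘ c) ss → ∃ λ d → F d × d ⊑ c × All (T ∘ d) ss) → F c) where

    Larger : (S → Bool) → (S → Bool) → Set _
    Larger c d = F d × c ⊑ d × ¬ d ⊑ c

    -- A positive answer of excluded middle carries a particular larger set, so the decision doubles
    -- as a choice function.
    grow′ : ∀ c → Dec (∃ (Larger c)) → S → Bool
    grow′ c (yes (d , _)) = d
    grow′ c (no _)        = c

    grow : (S → Bool) → S → Bool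
    grow c = grow′ c (decide _)

    grow-inflationary : ∀ c → c ⊑ grow c
    grow-inflationary c with decide (∃ (Larger c))
    ... | yes (_ , _ , c⊑d , _) = c⊑d
    ... | no _                  = id

    grow-F : ∀ c → F c → F (grow c)
    grow-F c Fc with decide (∃ (Larger c))
    ... | yes (_ , Fd , _) = Fd
    ... | no _             = Fc

    grow-stationary : ∀ {c d} → grow c ⊑ c → F d → c ⊑ d → d ⊑ c
    grow-stationary {c} {d} gc⊑c Fd c⊑d with decide (∃ (Larger c))
    ... | yes (_ , _ , _ , e⋢c) = contradiction (λ {s} → gc⊑c {s}) e⋢c
    ... | no ¬larger = stable λ d⋢c → ¬larger (d , Fd , c⊑d , λ d⊑c → d⋢c (λ {s} → d⊑c {s}))

    -- Adjoining `bot` makes the empty union equal to `bot`, so the tower starts there without a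
    -- constructor of its own.
    InUnion : ((S → Bool) → Bool) → S → Set x
    InUnion C s = T (bot s) ⊎ ∃ λ c → T (C c) × T (c s)

    ⋃ : ((S → Bool) → Bool) → S → Bool
    ⋃ C = ⟪ InUnion C ⟫

    ⋃-upper : ∀ C {c} → T (C c) → c ⊑ ⋃ C
    ⋃-upper C c∈C s∈c = ⟪⟫-intro (InUnion C) (inj₂ (_ , c∈C , s∈c))

    ⋃-least : ∀ C {d} → bot ⊑ d → (∀ c → T (C c) → c ⊑ d) → ⋃ C ⊑ d
    ⋃-least C bot⊑d C⊑d s∈⋃ with ⟪⟫-elim (InUnion C) s∈⋃
    ... | inj₁ s∈bot             = bot⊑d s∈bot
    ... | inj₂ (c , c∈C , s∈c) = C⊑d c c∈C s∈c

    data Tower : (S → Bool) → Set x where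
      step : ∀ {c} → Tower c → Tower (grow c)
      sup  : ∀ C → (∀ c → T (C c) → Tower c) → Tower (⋃ C)

    bot-least : ∀ {c} → Tower c → bot ⊑ c
    bot-least (step {c} tc) s∈bot = grow-inflationary c (bot-least tc s∈bot)
    bot-least (sup C _)     s∈bot = ⟪⟫-intro (InUnion C) (inj₁ s∈bot)

    -- The extreme points of the Bourbaki-Witt argument. Given `d ⊑ c`, the first alternative
    -- amounts to equality.
    Extreme : (S → Bool) → Set x
    Extreme c = ∀ {d} → Tower d → d ⊑ c → c ⊑ d ⊎ grow d ⊑ c

    -- Induction on the tower of `d`. A union either has a member above `grow c`, or has all its
    -- members below `c`.
    compare : ∀ {c d} → Tower c → Extreme c → Tower d → d ⊑ c ⊎ grow c ⊑ d
    compare {c} tc extreme (step {d} td) with compare tc extreme td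
    ... | inj₂ gc⊑d = inj₂ λ s∈ → grow-inflationary d (gc⊑d s∈)
    ... | inj₁ d⊑c with extreme td d⊑c
    -- `grow` rests on arbitrary choices and need not be monotone, so mutual inclusion is first
    -- turned into equality.
    ...   | inj₁ c⊑d  = inj₂ (subst (λ e → grow e ⊑ grow d) (⊑-antisym d⊑c c⊑d) id)
    ...   | inj₂ gd⊑c = inj₁ gd⊑c
    compare {c} tc extreme (sup C tC) with decide (∃ λ d → T (C d) × grow c ⊑ d)
    ... | yes (d , d∈C , gc⊑d) = inj₂ λ s∈ → ⋃-upper C d∈C (gc⊑d s∈)
    ... | no ¬above = inj₁ (⋃-least C (bot-least tc) below)
      where
      below : ∀ d → T (C d) → d ⊑ c
      below d d∈C with compare tc extreme (tC d d∈C)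
      ... | inj₁ d⊑c  = d⊑c
      ... | inj₂ gc⊑d = contradiction (d , d∈C , (λ {s} → gc⊑d {s})) ¬above

    -- Induction on `c`. For a union, either `d` contains every member, or some member escapes `d`;
    -- then `compare` forces `d` below that member, whose extremality applies.
    all-extreme : ∀ {c} → Tower c → Extreme c
    all-extreme (step {c} tc) td d⊑gc with compare tc (all-extreme tc) td
    ... | inj₂ gc⊑d = inj₁ gc⊑d
    ... | inj₁ d⊑c with all-extreme tc td d⊑c
    ...   | inj₁ c⊑d  = inj₂ (subst (λ e → grow e ⊑ grow c) (⊑-antisym c⊑d d⊑c) id)
    ...   | inj₂ gd⊑c = inj₂ λ s∈ → grow-inflationary c (gd⊑c s∈)
    all-extreme (sup C tC) {d} td d⊑⋃ with decide (∃ λ c → T (C c) × ¬ c ⊑ d)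
    ... | no ¬above = inj₁ (⋃-least C (bot-least td) below)
      where
      below : ∀ c → T (C c) → c ⊑ d
      below c c∈C = stable λ c⋢d → ¬above (c , c∈C , λ c⊑d → c⋢d (λ {s} → c⊑d {s}))
    ... | yes (c , c∈C , c⋢d) with compare (tC c c∈C) (all-extreme (tC c c∈C)) td
    ...   | inj₂ gc⊑d = contradiction (λ {s} s∈ → gc⊑d {s} (grow-inflationary c s∈)) c⋢d
    ...   | inj₁ d⊑c with all-extreme (tC c c∈C) td d⊑c
    ...     | inj₁ c⊑d  = contradiction (λ {s} → c⊑d {s}) c⋢d
    ...     | inj₂ gd⊑c = inj₂ λ s∈ → ⋃-upper C c∈C (gd⊑c s∈)

    chain : ∀ {c d} → Tower c → Tower d → c ⊑ d ⊎ d ⊑ c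
    chain {c} tc td with compare tc (all-extreme tc) td
    ... | inj₁ d⊑c  = inj₂ d⊑c
    ... | inj₂ gc⊑d = inj₁ λ s∈ → gc⊑d (grow-inflationary c s∈)

    tower-F : ∀ {c} → Tower c → F c
    tower-F (step tc)  = grow-F _ (tower-F tc)
    tower-F (sup C tC) = F-local _ local
      where
      -- The tower is linearly ordered, so among finitely many of its members one contains the rest.
      cover : ∀ ss → All (T ∘ ⋃ C) ss →
              All (T ∘ bot) ss ⊎ ∃ λ c → T (C c) × All (T ∘ c) ss
      cover []       []         = inj₁ []
      cover (s ∷ ss) (s∈ ∷ ss∈) with ⟪⟫-elim (InUnion C) s∈ | cover ss ss∈
      ... | inj₁ p             | inj₁ ps             = inj₁ (p ∷ ps)
      ... | inj₁ p             | inj₂ (d , d∈C , ps) = inj₂ (d , d∈C , bot-least (tC d d∈C) p ∷ ps)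
      ... | inj₂ (c , c∈C , p) | inj₁ ps             = inj₂ (c , c∈C , p ∷ All.map (bot-least (tC c c∈C)) ps)
      ... | inj₂ (c , c∈C , p) | inj₂ (d , d∈C , ps) with chain (tC c c∈C) (tC d d∈C)
      ...   | inj₁ c⊑d = inj₂ (d , d∈C , c⊑d p ∷ ps)
      ...   | inj₂ d⊑c = inj₂ (c , c∈C , p ∷ All.map d⊑c ps)

      local : ∀ ss → All (T ∘ ⋃ C) ss → ∃ λ d → F d × d ⊑ ⋃ C × All (T ∘ d) ss
      local ss ss∈ with cover ss ss∈
      ... | inj₁ ps             = bot , F-bot , (λ p → ⟪⟫-intro (InUnion C) (inj₁ p)) , ps
      ... | inj₂ (c , c∈C , ps) = c , tower-F (tC c c∈C) , ⋃-upper C c∈C , ps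

    -- The union `top` of the whole tower is itself in the tower, and so is `grow top`; hence
    -- `grow top ⊑ top`.
    maximal : ∃ λ c → F c × bot ⊑ c × (∀ d → F d → c ⊑ d → d ⊑ c)
    maximal = top , tower-F top-tower , bot-least top-tower ,
              λ d Fd top⊑d → grow-stationary (⋃-upper ⟪ Tower ⟫ (⟪⟫-intro Tower (step top-tower))) Fd top⊑d
      where
      top : S → Bool
      top = ⋃ ⟪ Tower ⟫

      top-tower : Tower top
      top-tower = sup ⟪ Tower ⟫ λ c → ⟪⟫-elim Tower

  -- Satisfaction under renaming, quantifier blocks and homomorphisms.

  module _ {L : Language ℓ} where

    ⊨-cong : (M : Structure L) (φ : Positive L n) {ā b̄ : Vector (Carrier M) n} →
             (∀ i → ā i ≡ b̄ i) → M ⊨ φ [ ā ] → M ⊨ φ [ b̄ ]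
    ⊨-cong M φ ā≗b̄ = subst (M ⊨ φ [_]) (ext ā≗b̄)

    eval-rename : (M : Structure L) (ρ : Fin m → Fin n) (ā : Vector (Carrier M) n)
                  (t : Term L m) → eval M ā (renameᵗ ρ t) ≡ eval M (ā ∘ ρ) t
    eval-rename M ρ ā (var i)    = refl
    eval-rename M ρ ā (app g ts) = cong (funcᴹ M g) (ext λ i → eval-rename M ρ ā (ts i))

    -- An equality of types rather than an equivalence, so that every connective is a congruence.
    ⊨-rename-≡ : (M : Structure L) (ρ : Fin m → Fin n) (ā : Vector (Carrier M) n)
                 (φ : Positive L m) → (M ⊨ rename ρ φ [ ā ]) ≡ (M ⊨ φ [ ā ∘ ρ ])
    ⊨-rename-≡ M ρ ā (atom falsity)    = refl
    ⊨-rename-≡ M ρ ā (atom (s ≐ t))    = cong₂ _≡_ (eval-rename M ρ ā s) (eval-rename M ρ ā t)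
    ⊨-rename-≡ M ρ ā (atom (rel R ts)) = cong (relᴹ M R) (ext λ i → eval-rename M ρ ā (ts i))
    ⊨-rename-≡ M ρ ā (φ ∧' ψ)          = cong₂ _×_ (⊨-rename-≡ M ρ ā φ) (⊨-rename-≡ M ρ ā ψ)
    ⊨-rename-≡ M ρ ā (φ ∨' ψ)          = cong₂ _⊎_ (⊨-rename-≡ M ρ ā φ) (⊨-rename-≡ M ρ ā ψ)
    ⊨-rename-≡ M ρ ā (∃' φ)            = cong ∃ (ext λ c →
      trans (⊨-rename-≡ M (Fin.lift 1 ρ) (c ∷ᵛ ā) φ)
            (cong (M ⊨ φ [_]) (ext λ { zero → refl ; (suc i) → refl })))

    ⊨-rename : (M : Structure L) (ρ : Fin m → Fin n) {ā : Vector (Carrier M) n}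
               (φ : Positive L m) → M ⊨ rename ρ φ [ ā ] ⇔ M ⊨ φ [ ā ∘ ρ ]
    ⊨-rename M ρ {ā} φ = mk⇔ (subst id (⊨-rename-≡ M ρ ā φ)) (subst id (sym (⊨-rename-≡ M ρ ā φ)))

    ∃*-intro : (M : Structure L) (z̄ : Vector (Carrier M) k) {ā : Vector (Carrier M) n}
               (φ : Positive L (k + n)) → M ⊨ φ [ z̄ ++ ā ] → M ⊨ ∃* k φ [ ā ]
    ∃*-intro {k = ℕ.zero}  M z̄     φ p = p
    ∃*-intro {k = ℕ.suc k} M z̄ {ā} φ p = ∃*-intro M (z̄ ∘ suc) (∃' φ) (z̄ zero , ⊨-cong M φ split p)
      where
      split : ∀ i → (z̄ ++ ā) i ≡ (z̄ zero ∷ᵛ ((z̄ ∘ suc) ++ ā)) i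
      split zero    = refl
      split (suc i) with splitAt k i
      ... | inj₁ _ = refl
      ... | inj₂ _ = refl

    ∃*-elim : (M : Structure L) {ā : Vector (Carrier M) n} (φ : Positive L (k + n)) →
              M ⊨ ∃* k φ [ ā ] → ∃ λ (z̄ : Vector (Carrier M) k) → M ⊨ φ [ z̄ ++ ā ]
    ∃*-elim {k = ℕ.zero}  M φ p = []ᵛ , p
    ∃*-elim {k = ℕ.suc k} M {ā} φ p with ∃*-elim {k = k} M (∃' φ) p
    ... | z̄ , c , q = c ∷ᵛ z̄ , ⊨-cong M φ join q
      where
      join : ∀ i → (c ∷ᵛ (z̄ ++ ā)) i ≡ ((c ∷ᵛ z̄) ++ ā) i
      join zero    = refl
      join (suc i) with splitAt k i
      ... | inj₁ _ = refl
      ... | inj₂ _ = refl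

    hom-positive : {M N : Structure L} (h : Hom M N) (φ : Positive L n) {ā : Vector (Carrier M) n} →
                   M ⊨ φ [ ā ] → N ⊨ φ [ map h ∘ ā ]
    hom-positive h (atom α) p        = Hom.preserves h α _ p
    hom-positive h (φ ∧' ψ) (p , q)  = hom-positive h φ p , hom-positive h ψ q
    hom-positive h (φ ∨' ψ) (inj₁ p) = inj₁ (hom-positive h φ p)
    hom-positive h (φ ∨' ψ) (inj₂ q) = inj₂ (hom-positive h ψ q)
    hom-positive {N = N} h (∃' φ) (c , p) =
      map h c , ⊨-cong N φ (map-∷ (map h) c _) (hom-positive h φ p)

  -- The canonical pc model of a finitely satisfiable set of facts.

  module Canonical {L : Language ℓ} (T′ : HInductiveTheory L) {X : Set ℓ}
    (Δ : Fact L X → Set ℓ) (Δ-sat : FinitelySatisfiable T′ Δ) where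

    C : Set ℓ
    C = Constant L X

    -- The fact that makes `wit φ v̄` usable has this very constant as a parameter, so in that
    -- position it supports itself.
    Active : (Fact L C → Bool) → C → Set
    Active Γ (base x)  = ⊤
    Active Γ (wit φ v̄) = T (Γ (φ at (wit φ v̄ ∷ᵛ v̄)))

    Active-mono : ∀ {Γ Γ′} → Γ ⊑ Γ′ → ∀ c → Active Γ c → Active Γ′ c
    Active-mono Γ⊑Γ′ (base x)  _ = tt
    Active-mono Γ⊑Γ′ (wit φ v̄) p = Γ⊑Γ′ p

    Supported : (Fact L C → Bool) → Set ℓ
    Supported Γ = ∀ s → T (Γ s) → ∀ i → Active Γ (params s i)

    Admissible : (Fact L C → Bool) → Set (Level.suc ℓ)
    Admissible Γ = Supported Γ × FinitelySatisfiable T′ (T ∘ Γ)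

    Base : Fact L C → Set ℓ
    Base s = ∃ λ d → Δ d × s ≡ formula d at (base ∘ params d)

    Base-admissible : Admissible ⟪ Base ⟫
    Base-admissible = supported , satisfiable
      where
      supported : Supported ⟪ Base ⟫
      supported s s∈ i with ⟪⟫-elim Base s∈
      ... | _ , _ , refl = tt

      underlying : ∀ fs → All (T ∘ ⟪ Base ⟫) fs → ∃ λ ds → All Δ ds ×
                   (∀ M e → All (Holds M (e ∘ base)) ds → All (Holds M e) fs)
      underlying []       []       = [] , [] , λ _ _ _ → []
      underlying (f ∷ fs) (p ∷ ps) with ⟪⟫-elim Base p | underlying fs ps
      ... | d , d∈Δ , refl | ds , ds∈Δ , lifts =
        d ∷ ds , d∈Δ ∷ ds∈Δ , λ { M e (q ∷ qs) → q ∷ lifts M e qs }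

      satisfiable : FinitelySatisfiable T′ (T ∘ ⟪ Base ⟫)
      satisfiable fs fs∈ with underlying fs fs∈
      ... | ds , ds∈Δ , lifts with Δ-sat ds ds∈Δ
      ...   | M , M⊨T , e , ds-hold = M , M⊨T , e⁺ , lifts M e⁺ ds-hold
        where
        e⁺ : C → Carrier M
        e⁺ (base x)  = e x
        -- No base fact mentions a witness, so any value serves.
        e⁺ (wit _ _) = Structure.inhabitant M

    -- A finite part of a supported set may omit the facts that support its parameters. The test
    -- therefore uses admissible subsets containing the finite list, not the list alone.
    Admissible-local : ∀ Γ → (∀ fs → All (T ∘ Γ) fs →
                       ∃ λ Γ′ → Admissible Γ′ × Γ′ ⊑ Γ × All (T ∘ Γ′) fs) → Admissible Γ
    Admissible-local Γ local = supported , satisfiable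
      where
      supported : Supported Γ
      supported s s∈Γ i with local (s ∷ []) (s∈Γ ∷ [])
      ... | Γ′ , (supported′ , _) , Γ′⊑Γ , s∈Γ′ ∷ [] = Active-mono Γ′⊑Γ (params s i) (supported′ s s∈Γ′ i)

      satisfiable : FinitelySatisfiable T′ (T ∘ Γ)
      satisfiable fs fs∈Γ with local fs fs∈Γ
      ... | _ , (_ , satisfiable′) , _ , fs∈Γ′ = satisfiable′ fs fs∈Γ′

    maximal-set : ∃ λ Γ → Admissible Γ × ⟪ Base ⟫ ⊑ Γ × (∀ Γ′ → Admissible Γ′ → Γ ⊑ Γ′ → Γ′ ⊑ Γ)
    maximal-set = Zorn.maximal Admissible ⟪ Base ⟫ Base-admissible Admissible-local

    Γ : Fact L C → Bool
    Γ = proj₁ maximal-set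

    Γ-supported : Supported Γ
    Γ-supported = proj₁ (proj₁ (proj₂ maximal-set))

    Γ-satisfiable : FinitelySatisfiable T′ (T ∘ Γ)
    Γ-satisfiable = proj₂ (proj₁ (proj₂ maximal-set))

    Γ-base : ⟪ Base ⟫ ⊑ Γ
    Γ-base = proj₁ (proj₂ (proj₂ maximal-set))

    Γ-maximal : ∀ Γ′ → Admissible Γ′ → Γ ⊑ Γ′ → Γ′ ⊑ Γ
    Γ-maximal = proj₂ (proj₂ (proj₂ maximal-set))

    infix 4 ∈Γ_

    ∈Γ_ : Fact L C → Set
    ∈Γ s = T (Γ s)

    Alive : C → Set
    Alive = Active Γ

    Extended : Fact L C → Fact L C → Set ℓ
    Extended s t = ∈Γ t ⊎ t ≡ s

    -- Adjoining `s` to `Γ` keeps it admissible. Parameters need only be active in the enlarged set,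
    -- which lets `s` activate its own witness.
    ∈Γ-maximal : ∀ s → (∀ i → Active ⟪ Extended s ⟫ (params s i)) →
                 (∀ fs → All ∈Γ_ fs → Satisfiable T′ (s ∷ fs)) → ∈Γ s
    ∈Γ-maximal s active sat =
      Γ-maximal ⟪ Extended s ⟫ (supported , satisfiable) old (⟪⟫-intro (Extended s) (inj₂ refl))
      where
      old : Γ ⊑ ⟪ Extended s ⟫
      old p = ⟪⟫-intro (Extended s) (inj₁ p)

      supported : Supported ⟪ Extended s ⟫
      supported t t∈ i with ⟪⟫-elim (Extended s) t∈
      ... | inj₁ t∈Γ  = Active-mono old (params t i) (Γ-supported t t∈Γ i)
      ... | inj₂ refl = active i

      satisfiable : FinitelySatisfiable T′ (T ∘ ⟪ Extended s ⟫)
      satisfiable fs fs∈ with separate fs (All.map (⟪⟫-elim (Extended s)) fs∈)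
      ... | gs , gs∈ , restore with sat gs gs∈
      ...   | M , M⊨T , e , p ∷ hold = M , M⊨T , e , restore p hold

    active-extended : ∀ s → (∀ i → Alive (params s i)) → ∀ i → Active ⟪ Extended s ⟫ (params s i)
    active-extended s alive i = Active-mono (λ p → ⟪⟫-intro (Extended s) (inj₁ p)) (params s i) (alive i)

    -- Consequences of finite parts of the maximal set.

    infix 3 ⊩_

    -- Semantic entailment from finitely many facts of `Γ`. The conclusion is any property of an
    -- interpretation, so negations and equalities of values can be entailed without a proof
    -- calculus.
    ⊩_ : (∀ M → (C → Carrier M) → Set ℓ) → Set (Level.suc ℓ)
    ⊩ Q = ∃ λ fs → All ∈Γ_ fs × (∀ M → M ⊨ᵀ T′ → ∀ e → All (Holds M e) fs → Q M e)

    ⊩-fact : ∀ {s} → ∈Γ s → ⊩ (λ M e → Holds M e s)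
    ⊩-fact {s} s∈ = s ∷ [] , s∈ ∷ [] , λ { _ _ _ (p ∷ []) → p }

    ⊩-mono : ∀ {Q R} → (∀ M → M ⊨ᵀ T′ → ∀ e → Q M e → R M e) → ⊩ Q → ⊩ R
    ⊩-mono Q⇒R (fs , fs∈ , q) = fs , fs∈ , λ M M⊨T e p → Q⇒R M M⊨T e (q M M⊨T e p)

    ⊩-valid : ∀ {Q} → (∀ M → M ⊨ᵀ T′ → ∀ e → Q M e) → ⊩ Q
    ⊩-valid q = [] , [] , λ M M⊨T e _ → q M M⊨T e

    ⊩-× : ∀ {Q R} → ⊩ Q → ⊩ R → ⊩ (λ M e → Q M e × R M e)
    ⊩-× (fs , fs∈ , q) (gs , gs∈ , r) =
      fs List.++ gs , ++⁺ fs∈ gs∈ , λ M M⊨T e p → q M M⊨T e (++⁻ˡ fs p) , r M M⊨T e (++⁻ʳ fs p)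

    ⊩-∀ : {Q : Fin k → ∀ M → (C → Carrier M) → Set ℓ} →
          (∀ i → ⊩ Q i) → ⊩ (λ M e → ∀ i → Q i M e)
    ⊩-∀ q = List.concat (List.tabulate (proj₁ ∘ q)) ,
            concat⁺ (tabulate⁺ (proj₁ ∘ proj₂ ∘ q)) ,
            λ M M⊨T e p i → proj₂ (proj₂ (q i)) M M⊨T e (tabulate⁻ (concat⁻ p) i)

    ∈Γ-closed : ∀ s → (∀ i → Alive (params s i)) → ⊩ (λ M e → Holds M e s) → ∈Γ s
    ∈Γ-closed s alive (fs , fs∈ , q) = ∈Γ-maximal s (active-extended s alive) sat
      where
      sat : ∀ gs → All ∈Γ_ gs → Satisfiable T′ (s ∷ gs)
      sat gs gs∈ with Γ-satisfiable (fs List.++ gs) (++⁺ fs∈ gs∈)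
      ... | M , M⊨T , e , hold = M , M⊨T , e , q M M⊨T e (++⁻ˡ fs hold) ∷ ++⁻ʳ fs hold

    -- By maximality an absent fact is unsatisfiable together with some finite part of `Γ`, and that
    -- part entails its negation.
    refuted : ∀ s → (∀ i → Alive (params s i)) → ¬ ∈Γ s → ⊩ (λ M e → ¬ Holds M e s)
    refuted s alive s∉ = stable λ ¬refuted → s∉ (∈Γ-maximal s (active-extended s alive) λ fs fs∈ →
      stable λ ¬sat → ¬refuted (fs , fs∈ , λ M M⊨T e hold p → ¬sat (M , M⊨T , e , p ∷ hold)))

    consistent : ¬ (⊩ (λ _ _ → Lift ℓ ⊥))
    consistent (fs , fs∈ , q) with Γ-satisfiable fs fs∈
    ... | M , M⊨T , e , hold = lower (q M M⊨T e hold)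

    -- If both disjuncts were missing, finite parts of `Γ` would refute each of them, and with the
    -- disjunction they would have no model.
    ∈Γ-∨ : (φ ψ : Positive L n) (v̄ : Vector C n) → ∈Γ (φ ∨' ψ) at v̄ → ∈Γ φ at v̄ ⊎ ∈Γ ψ at v̄
    ∈Γ-∨ φ ψ v̄ p with decide (∈Γ φ at v̄) | decide (∈Γ ψ at v̄)
    ... | yes q | _     = inj₁ q
    ... | no _  | yes r = inj₂ r
    ... | no φ∉ | no ψ∉ = contradiction
      (⊩-mono (λ { M _ e (inj₁ q , ¬q , ¬r) → contradiction q ¬q ; M _ e (inj₂ r , ¬q , ¬r) → contradiction r ¬r })
        (⊩-× (⊩-fact p) (⊩-× (refuted (φ at v̄) alive φ∉) (refuted (ψ at v̄) alive ψ∉))))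
      consistent
      where
      alive : ∀ i → Alive (v̄ i)
      alive = Γ-supported _ p

    -- A witness that is not alive occurs in no fact of Γ, so its value may be changed at will.

    ∈Γ-∃ : (φ : Positive L (ℕ.suc n)) (v̄ : Vector C n) → ∈Γ ∃' φ at v̄ → ∈Γ φ at (wit φ v̄ ∷ᵛ v̄)
    ∈Γ-∃ φ v̄ p = stable λ w∉ → w∉ (∈Γ-maximal s active (sat w∉))
      where
      w : C
      w = wit φ v̄

      s : Fact L C
      s = φ at (w ∷ᵛ v̄)

      active : ∀ i → Active ⟪ Extended s ⟫ ((w ∷ᵛ v̄) i)
      active zero    = ⟪⟫-intro (Extended s) (inj₂ refl)
      active (suc i) = Active-mono (λ q → ⟪⟫-intro (Extended s) (inj₁ q)) (v̄ i) (Γ-supported _ p i)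

      sat : ¬ Alive w → ∀ fs → All ∈Γ_ fs → Satisfiable T′ (s ∷ fs)
      sat w-dead fs fs∈ with Γ-satisfiable (∃' φ at v̄ ∷ fs) (p ∷ fs∈)
      ... | M , M⊨T , e , (c , q) ∷ hold =
        M , M⊨T , e[w] , ⊨-cong M φ value q ∷ All.zipWith (λ {f} → unchanged {f}) (fs∈ , hold)
        where
        update : ∀ v → Dec (v ≡ w) → Carrier M
        update v (yes _) = c
        update v (no _)  = e v

        e[w] : C → Carrier M
        e[w] v = update v (decide (v ≡ w))

        update-w : ∀ d → update w d ≡ c
        update-w (yes _)  = refl
        update-w (no w≢w) = contradiction refl w≢w

        update-alive : ∀ v → Alive v → ∀ d → update v d ≡ e v
        update-alive v v-alive (yes refl) = contradiction v-alive w-dead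
        update-alive v v-alive (no _)     = refl

        value : ∀ i → (c ∷ᵛ (e ∘ v̄)) i ≡ e[w] ((w ∷ᵛ v̄) i)
        value zero    = sym (update-w (decide _))
        value (suc i) = sym (update-alive (v̄ i) (Γ-supported _ p i) (decide _))

        unchanged : ∀ {f} → ∈Γ f × Holds M e f → Holds M e[w] f
        unchanged {ψ at _} (f∈ , holds) =
          ⊨-cong M ψ (λ i → sym (update-alive _ (Γ-supported _ f∈ i) (decide _))) holds

    -- Equality of constants modulo the maximal set, and representatives.

    equation : C → C → Fact L C
    equation v w = atom (var zero ≐ var (suc zero)) at (v ∷ᵛ w ∷ᵛ []ᵛ)

    infix 4 _≈_

    _≈_ : C → C → Set
    v ≈ w = ∈Γ equation v w

    ≈-intro : ∀ {v w} → Alive v → Alive w → ⊩ (λ M e → e v ≡ e w) → v ≈ w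
    ≈-intro v-alive w-alive = ∈Γ-closed (equation _ _) λ { zero → v-alive ; (suc zero) → w-alive }

    ≈-elim : ∀ {v w} → v ≈ w → ⊩ (λ M e → e v ≡ e w)
    ≈-elim = ⊩-fact

    ≈-refl : ∀ {v} → Alive v → v ≈ v
    ≈-refl v-alive = ≈-intro v-alive v-alive (⊩-valid λ _ _ _ → refl)

    ≈-sym : ∀ {v w} → v ≈ w → w ≈ v
    ≈-sym p = ≈-intro (Γ-supported _ p (suc zero)) (Γ-supported _ p zero)
      (⊩-mono (λ _ _ _ → sym) (≈-elim p))

    ≈-trans : ∀ {u v w} → u ≈ v → v ≈ w → u ≈ w
    ≈-trans p q = ≈-intro (Γ-supported _ p zero) (Γ-supported _ q (suc zero))
      (⊩-mono (λ { _ _ _ (r , s) → trans r s }) (⊩-× (≈-elim p) (≈-elim q)))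

    wit-alive : (φ : Positive L (ℕ.suc n)) (v̄ : Vector C n) → (∀ i → Alive (v̄ i)) →
                (∀ M → M ⊨ᵀ T′ → ∀ e → M ⊨ ∃' φ [ e ∘ v̄ ]) → Alive (wit φ v̄)
    wit-alive φ v̄ alive valid = ∈Γ-∃ φ v̄ (∈Γ-closed (∃' φ at v̄) alive (⊩-valid valid))

    point : C
    point = wit (atom (var zero ≐ var zero)) []ᵛ

    point-alive : Alive point
    point-alive = wit-alive _ []ᵛ (λ ()) λ M _ _ → Structure.inhabitant M , refl

    -- Since excluded middle for types is a choice operator, equal classes get
    -- equal representatives; this stands in for the quotient by ≈.

    pick : (c : C → Bool) → Dec (∃ λ u → T (c u)) → C
    pick c (yes (u , _)) = u
    pick c (no _)        = point

    pick-∈ : (c : C → Bool) {u : C} → T (c u) → (d : Dec (∃ λ u → T (c u))) → T (c (pick c d))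
    pick-∈ c u∈c (yes (_ , p)) = p
    pick-∈ c u∈c (no ¬p)       = contradiction (_ , u∈c) ¬p

    class : C → C → Bool
    class v u = Γ (equation v u)

    rep : C → C
    rep v = pick (class v) (decide _)

    ≈-rep : ∀ {v} → Alive v → v ≈ rep v
    ≈-rep {v} v-alive = pick-∈ (class v) {v} (≈-refl v-alive) (decide _)

    rep-cong : ∀ {v w} → v ≈ w → rep v ≡ rep w
    rep-cong {v} {w} v≈w = cong (λ c → pick c (decide _))
      (⊑-antisym {c = class v} {d = class w} (≈-trans (≈-sym v≈w)) (≈-trans v≈w))

    -- Irrelevance of `canonical` makes an element depend on its name alone; excluded middle
    -- recovers the proof where it is used.
    record Element : Set ℓ where
      constructor element
      field
        name       : C
        .canonical : Alive name × rep name ≡ name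

    open Element using (name)

    name-injective : ∀ {u w} → name u ≡ name w → u ≡ w
    name-injective refl = refl

    name-canonical : ∀ u → Alive (name u) × rep (name u) ≡ name u
    name-canonical (element _ p) = recompute (decide _) p

    name-alive : ∀ u → Alive (name u)
    name-alive u = proj₁ (name-canonical u)

    -- The value at constants that are not alive is junk.

    representative : ∀ v → Dec (Alive v) → Element
    representative v (yes v-alive) = element (rep v)
      (Γ-supported _ (≈-rep v-alive) (suc zero) , sym (rep-cong (≈-rep v-alive)))
    representative v (no _)        = element (rep point)
      (Γ-supported _ (≈-rep point-alive) (suc zero) , sym (rep-cong (≈-rep point-alive)))

    [_] : C → Element
    [ v ] = representative v (decide (Alive v))

    name-[] : ∀ {v} → Alive v → name [ v ] ≡ rep v
    name-[] {v} v-alive = go (decide (Alive v))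
      where
      go : ∀ d → name (representative v d) ≡ rep v
      go (yes _)     = refl
      go (no v-dead) = contradiction v-alive v-dead

    []-name : ∀ u → [ name u ] ≡ u
    []-name u = name-injective (trans (name-[] (name-alive u)) (proj₂ (name-canonical u)))

    ⊩-name-[] : ∀ {v} → Alive v → ⊩ (λ M e → e (name [ v ]) ≡ e v)
    ⊩-name-[] {v} v-alive = ≈-elim (≈-sym (subst (v ≈_) (sym (name-[] v-alive)) (≈-rep v-alive)))

    []-cong : ∀ u w → name u ≈ name w → u ≡ w
    []-cong u w p = name-injective
      (trans (sym (proj₂ (name-canonical u))) (trans (rep-cong p) (proj₂ (name-canonical w))))

    -- The structure built from representatives and its truth lemma.

    graph : Language.Func L n → Positive L (ℕ.suc n)
    graph g = atom (var zero ≐ app g (var ∘ suc))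

    -- Facts take constants, not terms, as parameters, so the value of a function is given by the
    -- witness of its graph.
    𝑴 : Structure L
    𝑴 = record
      { Carrier    = Element
      ; inhabitant = [ point ]
      ; funcᴹ      = λ g ū → [ wit (graph g) (name ∘ ū) ]
      ; relᴹ       = λ R ū → Lift ℓ (∈Γ atom (rel R var) at (name ∘ ū))
      }

    eval-𝑴 : (ū : Vector Element n) (t : Term L n) →
             ⊩ (λ M e → e (name (eval 𝑴 ū t)) ≡ eval M (e ∘ name ∘ ū) t)
    eval-𝑴 ū (var i)    = ⊩-valid λ _ _ _ → refl
    eval-𝑴 ū (app g ts) =
      ⊩-mono (λ { M _ e (p , q , r) → trans p (trans q (cong (funcᴹ M g) (ext r))) })
        -- `alive` is used twice: it makes the witness usable, and as a fact it is the defining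
        -- equation of the function value.
        (⊩-× (⊩-name-[] alive) (⊩-× (⊩-fact alive) (⊩-∀ λ i → eval-𝑴 ū (ts i))))
      where
      alive : Alive (wit (graph g) (λ i → name (eval 𝑴 ū (ts i))))
      alive = wit-alive (graph g) _ (λ i → name-alive (eval 𝑴 ū (ts i))) λ M _ e → _ , refl

    ∈Γ⇔ : (s t : Fact L C) → (∀ i → Alive (params s i)) → (∀ i → Alive (params t i)) →
          ⊩ (λ M e → Holds M e s ⇔ Holds M e t) → ∈Γ s ⇔ ∈Γ t
    ∈Γ⇔ s t s-alive t-alive eq = mk⇔
      (λ p → ∈Γ-closed t t-alive (⊩-mono (λ { _ _ _ (q , r) → to q r }) (⊩-× eq (⊩-fact p))))
      (λ p → ∈Γ-closed s s-alive (⊩-mono (λ { _ _ _ (q , r) → from q r }) (⊩-× eq (⊩-fact p))))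

    -- Induction on `φ`. Consistency and closure under entailment handle atoms and conjunctions;
    -- disjunctions need `∈Γ-∨`, existentials the witnesses.
    truth : (φ : Positive L n) (ū : Vector Element n) → 𝑴 ⊨ φ [ ū ] ⇔ ∈Γ φ at (name ∘ ū)
    truth (atom falsity) ū = mk⇔ (⊥-elim ∘ lower) (λ p → contradiction (⊩-fact p) consistent)
    truth (atom (s ≐ t)) ū = mk⇔
      (λ p → ∈Γ-closed _ (name-alive ∘ ū)
        (⊩-mono (λ { M _ e (q , r) → trans (sym q) (trans (cong (e ∘ name) p) r) })
          (⊩-× (eval-𝑴 ū s) (eval-𝑴 ū t))))
      (λ p → []-cong _ _ (≈-intro (name-alive (eval 𝑴 ū s)) (name-alive (eval 𝑴 ū t))
        (⊩-mono (λ { M _ e (q , r , p) → trans q (trans p (sym r)) })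
          (⊩-× (eval-𝑴 ū s) (⊩-× (eval-𝑴 ū t) (⊩-fact p))))))
    truth (atom (rel R ts)) ū = mk⇔ (to same ∘ lower) (lift ∘ from same)
      where
      same = ∈Γ⇔ (atom (rel R var) at (name ∘ λ i → eval 𝑴 ū (ts i))) (atom (rel R ts) at (name ∘ ū))
        (λ i → name-alive (eval 𝑴 ū (ts i))) (name-alive ∘ ū)
        (⊩-mono (λ M _ e p → mk⇔ (subst (relᴹ M R) (ext p)) (subst (relᴹ M R) (sym (ext p))))
          (⊩-∀ λ i → eval-𝑴 ū (ts i)))
    truth (φ ∧' ψ) ū = mk⇔
      (λ { (p , q) → ∈Γ-closed _ (name-alive ∘ ū) (⊩-× (⊩-fact (to (truth φ ū) p)) (⊩-fact (to (truth ψ ū) q))) })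
      (λ p → from (truth φ ū) (∈Γ-closed _ (name-alive ∘ ū) (⊩-mono (λ _ _ _ → proj₁) (⊩-fact p))) ,
             from (truth ψ ū) (∈Γ-closed _ (name-alive ∘ ū) (⊩-mono (λ _ _ _ → proj₂) (⊩-fact p))))
    truth (φ ∨' ψ) ū = mk⇔
      (λ { (inj₁ p) → ∈Γ-closed _ (name-alive ∘ ū) (⊩-mono (λ _ _ _ → inj₁) (⊩-fact (to (truth φ ū) p)))
         ; (inj₂ q) → ∈Γ-closed _ (name-alive ∘ ū) (⊩-mono (λ _ _ _ → inj₂) (⊩-fact (to (truth ψ ū) q))) })
      (Sum.map (from (truth φ ū)) (from (truth ψ ū)) ∘ ∈Γ-∨ φ ψ (name ∘ ū))
    truth (∃' φ) ū = mk⇔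
      (λ { (u , p) → ∈Γ-closed _ (name-alive ∘ ū)
        (⊩-mono (λ M _ e q → e (name u) , ⊨-cong M φ (map-∷ (e ∘ name) u ū) q)
          (⊩-fact (to (truth φ (u ∷ᵛ ū)) p))) })
      λ p → witnessed (∈Γ-∃ φ (name ∘ ū) p)
      where
      witnessed : Alive (wit φ (name ∘ ū)) → 𝑴 ⊨ ∃' φ [ ū ]
      witnessed alive = [ wit φ (name ∘ ū) ] , from (truth φ _)
        (∈Γ-closed _ (λ i → name-alive (([ wit φ (name ∘ ū) ] ∷ᵛ ū) i))
          (⊩-mono (λ { M _ e (p , q) → ⊨-cong M φ (λ { zero → sym p ; (suc i) → refl }) q })
            (⊩-× (⊩-name-[] alive) (⊩-fact alive))))

    -- The premise of an axiom, as a fact of `Γ`, entails the conclusion in every model of `T′`;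
    -- closure and the truth lemma return it to `𝑴`.
    𝑴-model : 𝑴 ⊨ᵀ T′
    𝑴-model χ χ∈T = All.tabulate satisfies
      where
      satisfies : ∀ {σ} → σ ∈ᴸ χ → 𝑴 ⊨ᵇ σ
      satisfies {σ} σ∈χ x̄ (ȳ , p) =
        conclude (∃*-elim 𝑴 ψ′ (from (truth (∃* #z ψ′) x̄) (∈Γ-closed _ (name-alive ∘ x̄) forced)))
        where
        open BasicHInductive σ

        -- `∃*` binds the leading variables, while an axiom places z̄ after x̄.
        swap : Fin (#x + #z) → Fin (#z + #x)
        swap = (λ i → #z ↑ʳ i) ++ (λ i → i ↑ˡ #x)

        swap-++ : {D : Set ℓ} (c̄ : Vector D #x) (d̄ : Vector D #z) → ∀ i → (d̄ ++ c̄) (swap i) ≡ (c̄ ++ d̄) i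
        swap-++ c̄ d̄ i with splitAt #x i
        ... | inj₁ j = lookup-++ʳ d̄ c̄ j
        ... | inj₂ j = lookup-++ˡ d̄ c̄ j

        ψ′ : Positive L (#z + #x)
        ψ′ = rename swap ψ

        forced : ⊩ (λ M e → M ⊨ ∃* #z ψ′ [ e ∘ name ∘ x̄ ])
        forced = ⊩-mono (λ M M⊨T e q → step M e (All.lookup (M⊨T χ χ∈T) σ∈χ _
            (e ∘ name ∘ ȳ , ⊨-cong M φ (map-++ (e ∘ name) x̄ ȳ) q)))
          (⊩-fact (to (truth φ (x̄ ++ ȳ)) p))
          where
          step : ∀ M (e : C → Carrier M) → (∃ λ z̄ → M ⊨ ψ [ (e ∘ name ∘ x̄) ++ z̄ ]) →
                 M ⊨ ∃* #z ψ′ [ e ∘ name ∘ x̄ ]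
          step M e (z̄ , q) = ∃*-intro M z̄ ψ′ (from (⊨-rename M swap ψ)
            (⊨-cong M ψ (λ i → sym (swap-++ _ z̄ i)) q))

        conclude : (∃ λ z̄ → 𝑴 ⊨ ψ′ [ z̄ ++ x̄ ]) → ∃ λ z̄ → 𝑴 ⊨ ψ [ x̄ ++ z̄ ]
        conclude (z̄ , q) = z̄ , ⊨-cong 𝑴 ψ (swap-++ x̄ z̄) (to (⊨-rename 𝑴 swap ψ) q)

    truth-[] : (φ : Positive L n) (v̄ : Vector C n) → ∈Γ φ at v̄ → 𝑴 ⊨ φ [ [_] ∘ v̄ ]
    truth-[] φ v̄ p = from (truth φ _) (∈Γ-closed _ (λ i → name-alive [ v̄ i ])
      (⊩-mono (λ { M _ e (q , r) → ⊨-cong M φ (λ i → sym (r i)) q })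
        (⊩-× (⊩-fact p) (⊩-∀ λ i → ⊩-name-[] (Γ-supported _ p i)))))

    -- A fact true in some continuation N of 𝑴 is consistent with Γ, as N itself shows.

    𝑴-pc : IsPCModel T′ 𝑴
    𝑴-pc = 𝑴-model , λ N N⊨T h φ ū → mk⇔ (hom-positive h φ) λ p → from (truth φ ū)
      (∈Γ-maximal (φ at (name ∘ ū)) (active-extended (φ at (name ∘ ū)) (name-alive ∘ ū)) λ fs fs∈ →
        N , N⊨T , map h ∘ [_] ,
        ⊨-cong N φ (λ i → cong (map h) (sym ([]-name (ū i)))) p ∷
        All.map (λ {f} f∈ → hom-positive h (formula f) (truth-[] (formula f) (params f) f∈)) fs∈)

    𝑴-Δ : ∀ f → Δ f → Holds 𝑴 ([_] ∘ base) f
    𝑴-Δ (φ at v̄) f∈Δ = truth-[] φ (base ∘ v̄) (Γ-base (⟪⟫-intro Base (_ , f∈Δ , refl)))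

  abstract

    -- Serves as the compactness theorem and, applied to the diagram of a model, as its continuation
    -- to a pc model.
    pc-model : {L : Language ℓ} (T′ : HInductiveTheory L) {X : Set ℓ} (Δ : Fact L X → Set ℓ) →
               FinitelySatisfiable T′ Δ →
               Σ (Structure L) λ M → IsPCModel T′ M × Σ (X → Carrier M) λ e → ∀ f → Δ f → Holds M e f
    pc-model T′ Δ Δ-sat = 𝑴 , 𝑴-pc , [_] ∘ base , 𝑴-Δ
      where open Canonical T′ Δ Δ-sat

  -- Finite positive diagrams.

  module _ {L : Language ℓ} where

    conjoin : (B : Structure L) (fs : List (Fact L (Carrier B))) → All (Holds B id) fs →
              ∃ λ (c : Fact L (Carrier B)) → Holds B id c ×
              (∀ M (e : Carrier B → Carrier M) → Holds M e c → All (Holds M e) fs)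
    conjoin B []             []       = verum at []ᵛ , (Structure.inhabitant B , refl) , λ _ _ _ → []
    conjoin B ((φ at b̄) ∷ fs) (p ∷ ps) with conjoin B fs ps
    ... | (χ at d̄) , q , extract =
      (rename (_↑ˡ _) φ ∧' rename (_ ↑ʳ_) χ) at (b̄ ++ d̄) ,
      (from (⊨-rename B (_↑ˡ _) φ) (⊨-cong B φ (λ i → sym (lookup-++ˡ b̄ d̄ i)) p) ,
       from (⊨-rename B (_ ↑ʳ_) χ) (⊨-cong B χ (λ i → sym (lookup-++ʳ b̄ d̄ i)) q)) ,
      λ { M e (r , s) →
        ⊨-cong M φ (λ i → cong e (lookup-++ˡ b̄ d̄ i)) (to (⊨-rename M (_↑ˡ _) φ) r) ∷
        extract M e (⊨-cong M χ (λ i → cong e (lookup-++ʳ b̄ d̄ i)) (to (⊨-rename M (_ ↑ʳ_) χ) s)) }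

    -- θ also records which parameters coincide, so that a realisation of θ is
    -- the restriction of a function on B.

    finite-diagram : (B : Structure L) (ā : Vector (Carrier B) n) (fs : List (Fact L (Carrier B))) →
      All (Holds B id) fs → ∃ λ (θ : Positive L n) → B ⊨ θ [ ā ] ×
      (∀ M (x̄ : Vector (Carrier M) n) → M ⊨ θ [ x̄ ] →
       Σ (Carrier B → Carrier M) λ e → (∀ i → e (ā i) ≡ x̄ i) × All (Holds M e) fs)
    finite-diagram {n = n} B ā fs fs-hold with conjoin B fs fs-hold
    ... | _at_ {k} χ d̄ , χ-holds , extract =
      ∃* k matrix ,
      ∃*-intro B d̄ matrix
        ( from (⊨-rename B (_↑ˡ n) χ) (⊨-cong B χ (λ i → sym (lookup-++ˡ d̄ ā i)) χ-holds)
        , ⋀-intro B coincidence (λ j → first-≡ j (decide _)) ) ,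
      λ M x̄ p → realise M x̄ (∃*-elim M matrix p)
      where
      params⁺ : Vector (Carrier B) (k + n)
      params⁺ = d̄ ++ ā

      valueAt : {Y : Set x} {b : Carrier B} → Y → Vector Y (k + n) → Dec (∃ λ i → params⁺ i ≡ b) → Y
      valueAt y w̄ (yes (i , _)) = w̄ i
      valueAt y w̄ (no _)        = y

      -- The chosen index depends only on the element at position `j`, so positions with equal
      -- parameters share it; it need not be the least.
      first : Fin (k + n) → Fin (k + n)
      first j = valueAt {b = params⁺ j} j id (decide _)

      first-≡ : ∀ j (d : Dec (∃ λ i → params⁺ i ≡ params⁺ j)) → params⁺ (valueAt j id d) ≡ params⁺ j
      first-≡ j (yes (_ , eq)) = eq
      first-≡ j (no _)         = refl

      valueAt-first : {Y : Set x} (y : Y) (w̄ : Vector Y (k + n)) →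
                      ∀ j (d : Dec (∃ λ i → params⁺ i ≡ params⁺ j)) → valueAt y w̄ d ≡ w̄ (valueAt j id d)
      valueAt-first y w̄ j (yes _) = refl
      valueAt-first y w̄ j (no ¬p) = contradiction (j , refl) ¬p

      coincidence : Fin (k + n) → Positive L (k + n)
      coincidence j = atom (var (first j) ≐ var j)

      matrix : Positive L (k + n)
      matrix = rename (_↑ˡ n) χ ∧' ⋀ coincidence

      realise : ∀ M (x̄ : Vector (Carrier M) n) → (∃ λ ȳ → M ⊨ matrix [ ȳ ++ x̄ ]) →
                Σ (Carrier B → Carrier M) λ e → (∀ i → e (ā i) ≡ x̄ i) × All (Holds M e) fs
      realise M x̄ (ȳ , p , q) = e ,
        (λ i → trans (cong e (sym (lookup-++ʳ d̄ ā i))) (trans (e-params (k ↑ʳ i)) (lookup-++ʳ ȳ x̄ i))) ,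
        extract M e (⊨-cong M χ
          (λ i → sym (trans (cong e (sym (lookup-++ˡ d̄ ā i))) (e-params (i ↑ˡ n))))
          (to (⊨-rename M (_↑ˡ n) χ) p))
        where
        e : Carrier B → Carrier M
        e b = valueAt {b = b} (Structure.inhabitant M) (ȳ ++ x̄) (decide _)

        e-params : ∀ j → e (params⁺ j) ≡ (ȳ ++ x̄) j
        e-params j = trans (valueAt-first _ (ȳ ++ x̄) j (decide _)) (⋀-elim M coincidence q j)

    diagram-hom : {B M : Structure L} (e : Carrier B → Carrier M) →
                  (∀ {n} (φ : Positive L n) b̄ → B ⊨ φ [ b̄ ] → M ⊨ φ [ e ∘ b̄ ]) → Hom B M
    diagram-hom e hold = record { map = e ; preserves = λ α → hold (atom α) }

    -- The two directions of the equivalence.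

    module _ (T′ : HInductiveTheory L) (A : Structure L) (A⊨T : A ⊨ᵀ T′) where

      Decisive : (Aₑ : Structure L) → Hom A Aₑ → Set (Level.suc ℓ)
      Decisive Aₑ f = (n : ℕ) (φ : Positive L n) (ā : Vector (Carrier A) n) →
        ¬ (Aₑ ⊨ φ [ map f ∘ ā ]) → ∃ λ (φᶜ : Positive L n) → φᶜ ∈ Res T′ φ × A ⊨ φᶜ [ ā ]

      decisive-of-amalgamation : IsAmalgamationBasis T′ A →
        Σ (Structure L) λ Aₑ → IsPCModel T′ Aₑ × Σ (Hom A Aₑ) (Decisive Aₑ)
      decisive-of-amalgamation (_ , amalgamate)
        with pc-model T′ (Holds A id) (λ fs fs-hold → A , A⊨T , id , fs-hold)
      ... | Aₑ , (Aₑ⊨T , immerse) , e , e-holds = Aₑ , (Aₑ⊨T , immerse) , f , decisive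
        where
        f : Hom A Aₑ
        f = diagram-hom e λ φ b̄ → e-holds (φ at b̄)

        decisive : Decisive Aₑ f
        decisive n φ ā ¬p = stable λ ¬φᶜ → ¬p (realised ¬φᶜ)
          where
          module _ (¬φᶜ : ¬ ∃ λ (φᶜ : Positive L n) → φᶜ ∈ Res T′ φ × A ⊨ φᶜ [ ā ]) where

            Δ : Fact L (Carrier A) → Set ℓ
            Δ s = Holds A id s ⊎ s ≡ φ at ā

            Δ-sat : FinitelySatisfiable T′ Δ
            Δ-sat fs fs∈ with separate fs fs∈
            ... | gs , gs-hold , restore with finite-diagram A ā gs gs-hold
            -- The diagram formula `θ` serves as φᶜ: a model realising `φ` and `θ` together would
            -- satisfy `fs`.
            ...   | θ , A⊨θ , realise = stable λ ¬sat → ¬φᶜ (θ , (λ { M M⊨T (x̄ , p , q) →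
                    let e′ , e′-ā , gs-hold′ = realise M x̄ q in
                    ¬sat (M , M⊨T , e′ , restore (⊨-cong M φ (sym ∘ e′-ā) p) gs-hold′) }) , A⊨θ)

            realised : Aₑ ⊨ φ [ map f ∘ ā ]
            realised with pc-model T′ Δ Δ-sat
            ... | B , (B⊨T , _) , e′ , e′-holds
              with amalgamate Aₑ B Aₑ⊨T B⊨T f (diagram-hom e′ λ ψ b̄ p → e′-holds (ψ at b̄) (inj₁ p))
            ...   | D , D⊨T , g′ , f′ , commute = from (immerse D D⊨T g′ φ (map f ∘ ā))
                      (⊨-cong D φ (λ i → sym (commute (ā i)))
                        (hom-positive f′ φ (e′-holds (φ at ā) (inj₂ refl))))

      module _ (B C : Structure L) (g : Hom A B) (h : Hom A C) where

        -- An interpretation of these facts in `D` amounts to homomorphisms from `B` and `C` to `D`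
        -- that agree on `A`.
        data Glued : Fact L (Carrier B ⊎ Carrier C) → Set ℓ where
          left  : (φ : Positive L n) (b̄ : Vector (Carrier B) n) → B ⊨ φ [ b̄ ] → Glued (φ at (inj₁ ∘ b̄))
          right : (φ : Positive L n) (c̄ : Vector (Carrier C) n) → C ⊨ φ [ c̄ ] → Glued (φ at (inj₂ ∘ c̄))
          glue  : ∀ a → Glued (atom (var zero ≐ var (suc zero)) at (inj₁ (map g a) ∷ᵛ inj₂ (map h a) ∷ᵛ []ᵛ))

        -- Finitely many facts identify only finitely many elements of `A`, kept in `shared`;
        -- agreement there suffices to recombine interpretations of the two sides.
        record Parts (fs : List (Fact L (Carrier B ⊎ Carrier C))) : Set (Level.suc ℓ) where
          field
            {size}  : ℕ
            shared  : Vector (Carrier A) size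
            lefts   : List (Fact L (Carrier B))
            rights  : List (Fact L (Carrier C))
            B-holds : All (Holds B id) lefts
            C-holds : All (Holds C id) rights
            rejoin  : ∀ M (e : Carrier B → Carrier M) (e′ : Carrier C → Carrier M) →
                      (∀ i → e (map g (shared i)) ≡ e′ (map h (shared i))) →
                      All (Holds M e) lefts → All (Holds M e′) rights → All (Holds M Sum.[ e , e′ ]) fs

        parts : ∀ fs → All Glued fs → Parts fs
        parts []       []       = record
          { shared = []ᵛ ; lefts = [] ; rights = [] ; B-holds = [] ; C-holds = []
          ; rejoin = λ _ _ _ _ _ _ → [] }
        parts (_ ∷ fs) (left φ b̄ p ∷ ps)  = record
          { shared = shared ; lefts = (φ at b̄) ∷ lefts ; rights = rights
          ; B-holds = p ∷ B-holds ; C-holds = C-holds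
          ; rejoin = λ { M e e′ eq (q ∷ qs) rs → q ∷ rejoin M e e′ eq qs rs } }
          where open Parts (parts fs ps)
        parts (_ ∷ fs) (right φ c̄ p ∷ ps) = record
          { shared = shared ; lefts = lefts ; rights = (φ at c̄) ∷ rights
          ; B-holds = B-holds ; C-holds = p ∷ C-holds
          ; rejoin = λ { M e e′ eq qs (r ∷ rs) → r ∷ rejoin M e e′ eq qs rs } }
          where open Parts (parts fs ps)
        parts (_ ∷ fs) (glue a ∷ ps)      = record
          { shared = a ∷ᵛ shared ; lefts = lefts ; rights = rights
          ; B-holds = B-holds ; C-holds = C-holds
          ; rejoin = λ M e e′ eq qs rs → eq zero ∷ rejoin M e e′ (eq ∘ suc) qs rs }
          where open Parts (parts fs ps)

      amalgamation-of-decisive : (Aₑ : Structure L) → Aₑ ⊨ᵀ T′ → (f : Hom A Aₑ) → Decisive Aₑ f →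
        IsAmalgamationBasis T′ A
      amalgamation-of-decisive Aₑ Aₑ⊨T f decisive = A⊨T , amalgamate
        where
        -- Otherwise some member of `Res T′ φ` would hold of `ā` in `A`, hence of its image in `B`,
        -- where `φ` holds too.
        reflects : (B : Structure L) → B ⊨ᵀ T′ → (g : Hom A B) (φ : Positive L n) (ā : Vector (Carrier A) n) →
                   B ⊨ φ [ map g ∘ ā ] → Aₑ ⊨ φ [ map f ∘ ā ]
        reflects B B⊨T g φ ā p = stable λ ¬q →
          let φᶜ , φᶜ∈Res , A⊨φᶜ = decisive _ φ ā ¬q in φᶜ∈Res B B⊨T (map g ∘ ā , p , hom-positive g φᶜ A⊨φᶜ)

        amalgamate : (B C : Structure L) → B ⊨ᵀ T′ → C ⊨ᵀ T′ → (g : Hom A B) (h : Hom A C) →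
          Σ (Structure L) λ D → D ⊨ᵀ T′ × Σ (Hom B D) λ g′ → Σ (Hom C D) λ h′ →
          ∀ a → map g′ (map g a) ≡ map h′ (map h a)
        amalgamate B C B⊨T C⊨T g h with pc-model T′ (Glued B C g h) satisfiable
          where
          satisfiable : FinitelySatisfiable T′ (Glued B C g h)
          satisfiable fs fs∈ =
            let open Parts (parts B C g h fs fs∈)
                θ , B⊨θ , realise   = finite-diagram B (map g ∘ shared) lefts B-holds
                θ′ , C⊨θ′ , realise′ = finite-diagram C (map h ∘ shared) rights C-holds
                -- Both diagram formulas hold in `Aₑ` at the same tuple, the image of `shared` under
                -- `f`, so the two interpretations agree there.
                e , e-shared , lefts-hold    = realise Aₑ (map f ∘ shared) (reflects B B⊨T g θ shared B⊨θ)
                e′ , e′-shared , rights-hold = realise′ Aₑ (map f ∘ shared) (reflects C C⊨T h θ′ shared C⊨θ′)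
            in Aₑ , Aₑ⊨T , Sum.[ e , e′ ] ,
               rejoin Aₑ e e′ (λ i → trans (e-shared i) (sym (e′-shared i))) lefts-hold rights-hold
        ... | D , (D⊨T , _) , e , e-holds = D , D⊨T ,
          diagram-hom (e ∘ inj₁) (λ φ b̄ p → e-holds _ (left φ b̄ p)) ,
          diagram-hom (e ∘ inj₂) (λ φ c̄ p → e-holds _ (right φ c̄ p)) ,
          λ a → e-holds _ (glue a)

theorem1 : (∀ a → ExcludedMiddle a) → (∀ a b → Extensionality a b) →
    (ℓ : Level) (L : Language ℓ) (T : HInductiveTheory L) (A : Structure L) → A ⊨ᵀ T →
    IsAmalgamationBasis T A ⇔
    (Σ (Structure L) λ Aₑ → IsPCModel T Aₑ ×
    Σ (Hom A Aₑ) λ f →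
    (n : ℕ) (φ : Positive L n) (ā : Vector (Carrier A) n) →
    ¬ (Aₑ ⊨ φ [ map f ∘ ā ]) →
    ∃ λ (φᶜ : Positive L n) → φᶜ ∈ Res T φ × A ⊨ φᶜ [ ā ])
theorem1 em fe ℓ L T A A⊨T = mk⇔ (decisive-of-amalgamation T A A⊨T)
  λ { (Aₑ , (Aₑ⊨T , _) , f , decisive) → amalgamation-of-decisive T A A⊨T Aₑ Aₑ⊨T f decisive }
  where open Classical em fe
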